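{- For every tree $T$, $\chi_{\mathrm{cen}}(T)\leq c\cdot\chi_{\mathrm{lin}}(T)$, where $c=\alpha\log 3<3.7$ and $\alpha=\log 3/\log\left(\frac{1+\sqrt5}{2}\right)$.
   Context: Logarithms are binary. A centered coloring of a graph $G$ assigns integers (colors) to vertices so that every connected subgraph contains a vertex whose color is unique in that subgraph; $\chi_{\mathrm{cen}}(G)$ is the minimum number of colors of such a coloring. A linear coloring requires the same only for every path of $G$ (as a subgraph); $\chi_{\mathrm{lin}}(G)$ is the minimum number of colors of a linear coloring. -}

module Defs where

open import Data.Nat using (ℕ; zero; suc; _+_; _*_; _∸_; _^_; _≤_; _<_)
open import Data.Fin using (Fin)
open import Data.Fin.Subset using (Subset; _∈_)
open import Data.List using (List; []; _∷_; _∷ʳ_; length)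
open import Data.List.Relation.Unary.All using (All)
open import Data.List.Relation.Unary.Linked using (Linked)
open import Data.List.Relation.Unary.Unique.Propositional using (Unique)
import Data.List.Membership.Propositional as L
open import Data.Product using (Σ; ∃; _×_)
open import Data.Sum using (_⊎_)
open import Relation.Nullary using (¬_)
open import Relation.Binary.PropositionalEquality using (_≡_)

record Graph (n : ℕ) : Set₁ where
  field
    Adj    : Fin n → Fin n → Set
    sym    : ∀ {u v} → Adj u v → Adj v u
    irrefl : ∀ {v} → ¬ Adj v v
open Graph public

module _ {n : ℕ} (G : Graph n) where

  IsPath : List (Fin n) → Set
  IsPath xs = (0 < length xs) × Unique xs × Linked (Adj G) xs

  IsCycle : List (Fin n) → Set
  IsCycle [] = Data.Empty.⊥ where import Data.Empty
  IsCycle (v ∷ xs) = (2 ≤ length xs) × Unique (v ∷ xs) × Linked (Adj G) ((v ∷ xs) ∷ʳ v)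

  ConnectedOn : Subset n → Set
  ConnectedOn S =
    (∃ λ v → v ∈ S) ×
    (∀ u v → u ∈ S → v ∈ S →
      u ≡ v ⊎ (∃ λ xs → All (_∈ S) xs × Linked (Adj G) ((u ∷ xs) ∷ʳ v)))

  IsTree : Set
  IsTree = ConnectedOn Data.Fin.Subset.⊤ × (∀ xs → ¬ IsCycle xs)
    where import Data.Fin.Subset

  -- centered coloring with k colors: every connected subgraph (given by its
  -- vertex set, which induces a connected subgraph) has a vertex whose color
  -- is unique in it
  IsCenteredColoring : {k : ℕ} → (Fin n → Fin k) → Set
  IsCenteredColoring col =
    ∀ S → ConnectedOn S →
      ∃ λ v → v ∈ S × (∀ w → w ∈ S → col w ≡ col v → w ≡ v)

  IsLinearColoring : {k : ℕ} → (Fin n → Fin k) → Set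
  IsLinearColoring col =
    ∀ xs → IsPath xs →
      ∃ λ v → v L.∈ xs × (∀ w → w L.∈ xs → col w ≡ col v → w ≡ v)

  IsChiCen : ℕ → Set
  IsChiCen k = (∃ λ (col : Fin n → Fin k) → IsCenteredColoring col) ×
               (∀ j → j < k → ¬ (∃ λ (col : Fin n → Fin j) → IsCenteredColoring col))

  IsChiLin : ℕ → Set
  IsChiLin k = (∃ λ (col : Fin n → Fin k) → IsLinearColoring col) ×
               (∀ j → j < k → ¬ (∃ λ (col : Fin n → Fin j) → IsLinearColoring col))

-- The constant c = α · log₂ 3,  α = log₂ 3 / log₂ φ = log_φ 3.
-- No reals: x ≤ c·L is expressed by comparison with all rational upper
-- bounds of log₂ 3 and log_φ 3.

fib : ℕ → ℕ
fib zero = 0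
fib (suc zero) = 1
fib (suc (suc n)) = fib (suc n) + fib n

lucas : ℕ → ℕ
lucas zero = 2
lucas (suc zero) = 1
lucas (suc (suc n)) = lucas (suc n) + lucas n

-- u + v·√5 > w
GtSqrt5 : ℕ → ℕ → ℕ → Set
GtSqrt5 u v w = w < u ⊎ (u ≤ w × (w ∸ u) ^ 2 < 5 * v ^ 2)

UpperLog2of3 : ℕ → ℕ → Set
UpperLog2of3 p q = 0 < q × 3 ^ q < 2 ^ p

-- a/b > log_φ 3  (i.e. φ^a > 3^b, b > 0; φ^a = (L_a + F_a √5)/2)
UpperLogPhiOf3 : ℕ → ℕ → Set
UpperLogPhiOf3 a b = 0 < b × GtSqrt5 (lucas a) (fib a) (2 * 3 ^ b)

LeC* : ℕ → ℕ → Set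
LeC* x L = ∀ p q a b → UpperLog2of3 p q → UpperLogPhiOf3 a b →
           x * q * b ≤ L * p * a

{-# OPTIONS --safe #-}
-- In fact 2 ^ χcen ≤ 9 ^ χlin, which suffices because φ² < 3 gives 2 < log_φ 3.
--
-- Root T, and let b v be the largest number of vertices of a subtree with top v
-- in which every vertex has at most two children.
--
-- Lower bound on χlin.  Let a linear coloring with k colors be given, together
-- with such a binary subtree on m vertices.  Its vertices and its empty child
-- slots form 2m + 1 positions.  Walk down from the top to a position and, at each
-- vertex that is left through its first (second) slot, add 1 (2) to the coordinate
-- of its color in (ℤ/3)^k.  Different positions get different vectors: they
-- differ in the coordinate of the uniquely colored vertex of the path between
-- them, from which a position at a lower end is left out.  Hence 2m + 1 ≤ 3 ^ k.
--
-- Upper bound on χcen.  Distinct children u, u′ of v satisfy b u + b u′ < b v.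
-- This yields, by simultaneous induction on j, centered colorings with 2j colors
-- of the subtree below v if b v < 2 ^ j, and with 2j + 1 colors of the part
-- below a but not below c if b a < b c + 2 ^ j.  In the first case remove the
-- lowest vertex with b ≥ 2 ^ (j-1); in the second, the lowest vertex m on the path
-- from a to c with b m ≥ b c + 2 ^ (j-1).
module Submission where

open import Defs hiding (sym)
open import Data.Empty using (⊥-elim)
open import Data.Fin using (Fin; zero; suc; fromℕ<; funToFin; finToFun)
open import Data.Fin.Properties using (_≟_; any?; fromℕ<-injective; injective⇒≤; finToFun-funToFin; sequence)
open import Data.Fin.Subset using () renaming (_∈_ to _∈ₛ_)
open import Data.Fin.Subset.Properties using (∈⊤) renaming (_∈?_ to _∈ₛ?_)
open import Data.List using (List; []; _∷_; _∷ʳ_; _++_; _ʳ++_; length; drop; map; reverse; lookup)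
open import Data.List.Properties using (++-assoc; ++-cancelʳ; ∷ʳ-++; ∷ʳ-injectiveʳ; ≡-dec; length-++; length-map)
import Data.List.Membership.DecPropositional as DecMembership
open import Data.List.Membership.Propositional using (_∈_; _∉_)
open import Data.List.Membership.Propositional.Properties using (∈-∃++; ∈-++⁺ʳ; ∈-++⁺ˡ; ∈-++⁻; ∈-lookup)
open import Data.List.Relation.Binary.Disjoint.Propositional using (Disjoint)
open import Data.List.Relation.Binary.Permutation.Setoid using (↭-sym)
import Data.List.Relation.Binary.Permutation.Setoid.Properties as Perm
open import Data.List.Relation.Unary.All as All using (All; []; _∷_)
import Data.List.Relation.Unary.All.Properties as AllP
open import Data.List.Relation.Unary.AllPairs as AllPairs using (AllPairs; []; _∷_)
import Data.List.Relation.Unary.AllPairs.Properties as AllPairsP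
open import Data.List.Relation.Unary.Any using (here; there)
import Data.List.Relation.Unary.Any.Properties as AnyP
open import Data.List.Relation.Unary.Linked using (Linked; [-]; _∷_)
open import Data.List.Relation.Unary.Unique.Propositional using (Unique)
import Data.List.Relation.Unary.Unique.Propositional.Properties as UniqueP
open import Data.Nat using (ℕ; zero; suc; _+_; _*_; _∸_; _^_; _≤_; _<_; z≤n; s≤s; s≤s⁻¹)
open import Data.Nat.Properties hiding (_≟_)
open import Data.Nat.Solver using (module +-*-Solver)
open import Data.Product using (∃; _×_; _,_; proj₁; proj₂)
open import Data.Sum using (_⊎_; inj₁; inj₂)
open import Effect.Monad using (RawMonad)
open import Function using (_∘_; id)
open import Level using (0ℓ)
open import Relation.Binary.Construct.Closure.ReflexiveTransitive as Star using (Star; ε; _◅_; _◅◅_)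
open import Relation.Binary.Core using (Rel)
open import Relation.Binary.PropositionalEquality using (_≡_; _≢_; refl; sym; trans; cong; cong₂; subst; setoid)
open import Relation.Nullary using (¬_; Dec; yes; no)
open import Relation.Nullary.Decidable using (_×-dec_; decidable-stable)
open import Relation.Nullary.Negation using (¬¬-Monad)

-- Simple paths and loop erasure

data SimplePath {V : Set} (R : Rel V 0ℓ) : V → V → List V → Set where
  stop : ∀ {v} → SimplePath R v v (v ∷ [])
  step : ∀ {u w v xs} → R u w → All (u ≢_) xs → SimplePath R w v xs → SimplePath R u v (u ∷ xs)

module _ {V : Set} {R : Rel V 0ℓ} where

  simple-unique : ∀ {u v xs} → SimplePath R u v xs → Unique xs
  simple-unique stop         = [] ∷ []
  simple-unique (step _ a p) = a ∷ simple-unique p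

  simple-linked : ∀ {u v xs} → SimplePath R u v xs → Linked R xs
  simple-linked stop                      = [-]
  simple-linked (step r _ stop)           = r ∷ [-]
  simple-linked (step r _ p@(step _ _ _)) = r ∷ simple-linked p

  simple-linked-∷ʳ : ∀ {u v z xs} → SimplePath R u v xs → R v z → Linked R (xs ∷ʳ z)
  simple-linked-∷ʳ stop                      s = s ∷ [-]
  simple-linked-∷ʳ (step r _ stop)           s = r ∷ s ∷ [-]
  simple-linked-∷ʳ (step r _ p@(step _ _ _)) s = r ∷ simple-linked-∷ʳ p s

  simple-head : ∀ {u v x xs} → SimplePath R u v (x ∷ xs) → u ≡ x
  simple-head stop         = refl
  simple-head (step _ _ _) = refl

  simple-source : ∀ {u v xs} → SimplePath R u v xs → u ∈ xs
  simple-source stop         = here refl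
  simple-source (step _ _ _) = here refl

  simple-target : ∀ {u v xs} → SimplePath R u v xs → v ∈ xs
  simple-target stop         = here refl
  simple-target (step _ _ p) = there (simple-target p)

  simple-suffix : ∀ {u v y ys} xs → SimplePath R u v (xs ++ y ∷ ys) → SimplePath R y v (y ∷ ys)
  simple-suffix []           stop         = stop
  simple-suffix []           (step r a p) = step r a p
  simple-suffix (_ ∷ x ∷ xs) (step r a p) = simple-suffix (x ∷ xs) p
  simple-suffix (_ ∷ [])     (step r a p) = simple-suffix [] p

linked⇒star : ∀ {V : Set} {R : Rel V 0ℓ} {u v} xs → Linked R ((u ∷ xs) ∷ʳ v) → Star R u v
linked⇒star []       (r ∷ _) = r ◅ ε
linked⇒star (x ∷ xs) (r ∷ l) = r ◅ linked⇒star xs l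

module _ {n : ℕ} where
  open DecMembership (_≟_ {n}) public using (_∈?_)

∉⇒All≢ : ∀ {V : Set} {x : V} {xs} → x ∉ xs → All (x ≢_) xs
∉⇒All≢ x∉ = All.tabulate λ { y∈ refl → x∉ y∈ }

-- If `u` already occurs on the path built from the rest of the walk, the suffix starting at that
-- occurrence is taken instead.
eraseLoops : ∀ {n} {R : Rel (Fin n) 0ℓ} {u v} → Star R u v → ∃ (SimplePath R u v)
eraseLoops ε = _ , stop
eraseLoops {u = u} (r ◅ s) with eraseLoops s
... | xs , p with u ∈? xs
...   | no u∉  = _ , step r (∉⇒All≢ u∉) p
...   | yes u∈ with ys , zs , refl ← ∈-∃++ u∈ = _ , simple-suffix ys p

-- Rooting the tree: unique paths, parents and ancestors

module Rooted {n : ℕ} (T : Graph n) (tree : IsTree T) where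

  V : Set
  V = Fin n

  root : V
  root = proj₁ (proj₁ (proj₁ tree))

  Avoiding : V → Rel V 0ℓ
  Avoiding x a b = Adj T a b × x ≢ a × x ≢ b

  avoiding-sym : ∀ {x a b} → Avoiding x a b → Avoiding x b a
  avoiding-sym (e , p , q) = Graph.sym T e , q , p

  -- Erasing the loops of the walk and closing it up through `x` would give a cycle.
  no-fork : ∀ {x y z} → Adj T x y → Adj T x z → y ≢ z → ¬ Star (Avoiding x) y z
  no-fork {x} {y} {z} xy xz y≢z s with eraseLoops s
  ... | xs , stop = y≢z refl
  ... | _ , p@(step {xs = w ∷ ws} r@(_ , x≢y , _) a q) =
    proj₂ tree (x ∷ _) (s≤s (s≤s z≤n) , avoids p x≢y ∷ simple-unique p , xy ∷ closing p)
    where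
    avoids : ∀ {u v xs} → SimplePath (Avoiding x) u v xs → x ≢ u → All (x ≢_) xs
    avoids stop                       x≢u = x≢u ∷ []
    avoids (step (_ , _ , x≢w) _ p′) x≢u = x≢u ∷ avoids p′ x≢w
    closing : ∀ {u xs} → SimplePath (Avoiding x) u z xs → Linked (Adj T) (xs ∷ʳ x)
    closing p′ = simple-linked-∷ʳ (forget p′) (Graph.sym T xz)
      where
      forget : ∀ {u xs} → SimplePath (Avoiding x) u z xs → SimplePath (Adj T) u z xs
      forget stop         = stop
      forget (step r a p) = step (proj₁ r) a (forget p)

  simple⇒avoiding : ∀ {x u v xs} → All (x ≢_) xs → SimplePath (Adj T) u v xs → Star (Avoiding x) u v
  simple⇒avoiding _           stop         = ε
  simple⇒avoiding (x≢u ∷ a) (step r _ p) =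
    (r , x≢u , All.lookup a (simple-source p)) ◅ simple⇒avoiding a p

  -- Where two paths first part, the rest of one followed by the reversed rest of the other is a
  -- walk avoiding the branching vertex, against `no-fork`.
  simple-path-unique : ∀ {u v xs ys} → SimplePath (Adj T) u v xs → SimplePath (Adj T) u v ys → xs ≡ ys
  simple-path-unique stop stop = refl
  simple-path-unique stop (step _ a q) = ⊥-elim (All.lookup a (simple-target q) refl)
  simple-path-unique (step _ a p) stop = ⊥-elim (All.lookup a (simple-target p) refl)
  simple-path-unique {u} (step {w = y} r a p) (step {w = z} s b q) with y ≟ z
  ... | yes refl = cong (u ∷_) (simple-path-unique p q)
  ... | no y≢z   = ⊥-elim (no-fork r s y≢z
                     (simple⇒avoiding a p ◅◅ Star.reverse avoiding-sym (simple⇒avoiding b q)))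

  root-walk : ∀ w → Star (Adj T) w root
  root-walk w with proj₂ (proj₁ tree) w root ∈⊤ ∈⊤
  ... | inj₁ refl         = ε
  ... | inj₂ (xs , _ , l) = linked⇒star xs l

  -- The vertices on the path from w up to the root, starting with w; hence
  -- u ∈ toRoot w says that u is an ancestor of w, or w itself.
  abstract
    toRoot : V → List V
    toRoot w = proj₁ (eraseLoops (root-walk w))

    toRoot-simple : ∀ w → SimplePath (Adj T) w root (toRoot w)
    toRoot-simple w = proj₂ (eraseLoops (root-walk w))

  toRoot-unique : ∀ w → Unique (toRoot w)
  toRoot-unique w = simple-unique (toRoot-simple w)

  toRoot-suffix : ∀ {w y ys} xs → toRoot w ≡ xs ++ y ∷ ys → toRoot y ≡ y ∷ ys
  toRoot-suffix {w} {y} xs eq = simple-path-unique (toRoot-simple y)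
    (simple-suffix xs (subst (SimplePath (Adj T) w root) eq (toRoot-simple w)))

  self∈toRoot : ∀ w → w ∈ toRoot w
  self∈toRoot w = simple-source (toRoot-simple w)

  root∈toRoot : ∀ w → root ∈ toRoot w
  root∈toRoot w = simple-target (toRoot-simple w)

  -- An equality of lists rather than a condition on `Adj`, so that it is decidable although `Adj`
  -- need not be.
  Child : V → V → Set
  Child u v = toRoot u ≡ u ∷ toRoot v

  toRoot-cases : ∀ w → toRoot w ≡ w ∷ [] ⊎ ∃ (Child w)
  toRoot-cases w with toRoot w in eq | toRoot-simple w
  ... | _ | stop = inj₁ refl
  ... | _ ∷ y ∷ ys | step {w = z} r a p = inj₂ (y , cong (w ∷_) (sym (toRoot-suffix (w ∷ []) eq)))

  toRoot-∷ : ∀ w → toRoot w ≡ w ∷ drop 1 (toRoot w)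
  toRoot-∷ w with toRoot-cases w
  ... | inj₁ e       rewrite e = refl
  ... | inj₂ (z , e) rewrite e = refl

  -- Either `y` is off the path from `x` to the root and can be put in front of it, or the path from
  -- `y` is a suffix without `x`, and `x` can be put in front of that. Uniqueness of paths
  -- identifies the result.
  adjacent⇒child : ∀ {x y} → Adj T x y → Child x y ⊎ Child y x
  adjacent⇒child {x} {y} e with y ∈? toRoot x
  ... | no y∉ = inj₂ (simple-path-unique (toRoot-simple y)
                  (step (Graph.sym T e) (∉⇒All≢ y∉) (toRoot-simple x)))
  ... | yes y∈ with ∈-∃++ y∈
  ...   | [] , ys , eq = ⊥-elim (irrefl T (subst (λ z → Adj T z y) x≡y e))
    where x≡y = simple-head (subst (SimplePath (Adj T) x root) eq (toRoot-simple x))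
  ...   | z ∷ zs , ys , eq = inj₁ (simple-path-unique (toRoot-simple x)
                               (step e (subst (All (x ≢_)) (sym y-path) x∉) (toRoot-simple y)))
    where
    y-path : toRoot y ≡ y ∷ ys
    y-path = toRoot-suffix (z ∷ zs) eq
    x≡z : x ≡ z
    x≡z = simple-head (subst (SimplePath (Adj T) x root) eq (toRoot-simple x))
    x∉ : All (x ≢_) (y ∷ ys)
    x∉ with subst Unique eq (toRoot-unique x)
    ... | a ∷ _ = All.tabulate λ w∈ x≡w → All.lookup a (∈-++⁺ʳ zs w∈) (trans (sym x≡z) x≡w)

  ancestor-trans : ∀ {u v w} → u ∈ toRoot v → v ∈ toRoot w → u ∈ toRoot w
  ancestor-trans {u} u∈ v∈ with xs , ys , eq ← ∈-∃++ v∈ =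
    subst (u ∈_) (sym eq) (∈-++⁺ʳ xs (subst (u ∈_) (toRoot-suffix xs eq) u∈))

  child⇒ancestor : ∀ {u v} → Child u v → v ∈ toRoot u
  child⇒ancestor {u} {v} c = subst (v ∈_) (sym c) (there (self∈toRoot v))

  child-split : ∀ {u v x} → Child u v → u ∈ toRoot x → ∃ λ xs → toRoot x ≡ (xs ∷ʳ u) ++ toRoot v
  child-split {u} {v} c u∈ with xs , ys , eq ← ∈-∃++ u∈ =
    xs , trans eq (trans (cong (xs ++_) (trans (sym (toRoot-suffix xs eq)) c)) (sym (∷ʳ-++ xs u _)))

  -- Both children stand directly before the same suffix `toRoot v` of `toRoot x`.
  siblings-disjoint : ∀ {u u′ v x} → Child u v → Child u′ v → u ∈ toRoot x → u′ ∈ toRoot x → u ≡ u′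
  siblings-disjoint {v = v} c c′ u∈ u′∈
    with xs , eq ← child-split c u∈ | xs′ , eq′ ← child-split c′ u′∈ =
    ∷ʳ-injectiveʳ xs xs′ (++-cancelʳ (toRoot v) _ _ (trans (sym eq) eq′))

  data Binary (v : V) : ℕ → Set where
    leaf : Binary v 1
    one  : ∀ {u m} → Child u v → Binary u m → Binary v (suc m)
    two  : ∀ {u u′ m m′} → Child u v → Child u′ v → u ≢ u′ → Binary u m → Binary u′ m′ → Binary v (suc (m + m′))

-- Centered colorings built by removing vertices

2^suc : ∀ j → 2 ^ suc j ≡ 2 ^ j + 2 ^ j
2^suc j = cong (2 ^ j +_) (+-identityʳ (2 ^ j))

double : ℕ → ℕ
double zero    = zero
double (suc j) = suc (suc (double j))

module Ranking {n : ℕ} (T : Graph n) (tree : IsTree T) where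
  open Rooted T tree

  -- The entry preceding m in x ∷ xs, with junk value m if m is not in xs.
  before : V → V → List V → V
  before m x [] = m
  before m x (y ∷ ys) with y ≟ m
  ... | yes _ = x
  ... | no _  = before m y ys

  before-∷ : ∀ {m y} x ys → y ≢ m → before m x (y ∷ ys) ≡ before m y ys
  before-∷ {m} {y} x ys y≢m with y ≟ m
  ... | yes y≡m = ⊥-elim (y≢m y≡m)
  ... | no _    = refl

  -- Indexes the components of T − m: the child of m above w, or m itself when
  -- w does not lie strictly below m.
  branch : V → V → V
  branch m w = before m w (drop 1 (toRoot w))

  -- `drop 1 (toRoot y)` is `toRoot x`; it begins with `x`, which is not `m`, so the search
  -- continues exactly as it does for `x`.
  branch-child : ∀ {m x y} → Child y x → x ≢ m → branch m y ≡ branch m x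
  branch-child {m} {x} {y} c x≢m with toRoot-cases x
  ... | inj₁ e rewrite c | e = before-∷ y [] x≢m
  ... | inj₂ (z , e) rewrite c | e = before-∷ y (toRoot z) x≢m

  branch-adjacent : ∀ {m x y} → Adj T x y → x ≢ m → y ≢ m → branch m x ≡ branch m y
  branch-adjacent e x≢m y≢m with adjacent⇒child e
  ... | inj₁ c = branch-child c y≢m
  ... | inj₂ c = sym (branch-child c x≢m)

  branch-below : ∀ {m} w → branch m w ≢ m → Child (branch m w) m × branch m w ∈ toRoot w
  branch-below {m} w b≢m =
    let c , b∈ = go (drop 1 (toRoot w)) (toRoot-∷ w) b≢m
    in  c , subst (branch m w ∈_) (sym (toRoot-∷ w)) b∈
    where
    go : ∀ {x} xs → toRoot x ≡ x ∷ xs → before m x xs ≢ m → Child (before m x xs) m × before m x xs ∈ x ∷ xs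
    go []       _ b≢m = ⊥-elim (b≢m refl)
    go {x} (y ∷ ys) eq b≢m with y ≟ m
    ... | yes refl = trans eq (cong (x ∷_) (sym (toRoot-suffix (x ∷ []) eq))) , here refl
    ... | no _     with c , b∈ ← go ys (toRoot-suffix (x ∷ []) eq) b≢m = c , there b∈

  branch-outside : ∀ {m} w → w ≢ m → branch m w ≡ m → m ∉ toRoot w
  branch-outside {m} w w≢m eq m∈ = go (drop 1 (toRoot w)) (w≢m ∘ sym) eq (subst (m ∈_) (toRoot-∷ w) m∈)
    where
    go : ∀ {x} xs → m ≢ x → before m x xs ≡ m → m ∉ x ∷ xs
    go _ m≢x _ (here m≡x) = m≢x m≡x
    go (y ∷ ys) m≢x eq (there m∈) with y ≟ m
    ... | yes _  = m≢x (sym eq)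
    ... | no y≢m = go ys (y≢m ∘ sym) eq m∈

  connected-constant : ∀ {A : Set} (f : V → A) {S} → ConnectedOn T S →
    (∀ {x y} → x ∈ₛ S → y ∈ₛ S → Adj T x y → f x ≡ f y) →
    ∀ {u v} → u ∈ₛ S → v ∈ₛ S → f u ≡ f v
  connected-constant f {S} conn const {u} {v} u∈ v∈ with proj₂ conn u v u∈ v∈
  ... | inj₁ refl         = refl
  ... | inj₂ (xs , a , l) = go xs u∈ a l
    where
    go : ∀ {u} xs → u ∈ₛ S → All (_∈ₛ S) xs → Linked (Adj T) ((u ∷ xs) ∷ʳ v) → f u ≡ f v
    go []       u∈ _        (e ∷ _) = const u∈ v∈ e
    go (x ∷ xs) u∈ (x∈ ∷ a) (e ∷ l) = trans (const u∈ x∈ e) (go xs x∈ a l)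

  -- Colors are natural numbers on all of `V`, bounded only on `X`, so that colorings of different
  -- parts can be merged without changing types.
  Ranked : ℕ → (V → Set) → Set
  Ranked d X = ∃ λ (col : V → ℕ) → (∀ {w} → X w → col w < d) ×
    (∀ S → ConnectedOn T S → (∀ {w} → w ∈ₛ S → X w) →
      ∃ λ v → v ∈ₛ S × (∀ w → w ∈ₛ S → col w ≡ col v → w ≡ v))

  ranked-⊆ : ∀ {d d′ X Y} → d ≤ d′ → (∀ {w} → Y w → X w) → Ranked d X → Ranked d′ Y
  ranked-⊆ d≤d′ Y⊆X (col , bound , centre) =
    col , (λ y → <-≤-trans (bound (Y⊆X y)) d≤d′) , λ S conn S⊆Y → centre S conn (Y⊆X ∘ S⊆Y)

  ranked-∅ : ∀ {d X} → (∀ {w} → ¬ X w) → Ranked d X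
  ranked-∅ empty = (λ _ → 0) , (λ x → ⊥-elim (empty x)) ,
    λ S conn S⊆X → ⊥-elim (empty (S⊆X (proj₂ (proj₁ conn))))

  -- `m` gets the fresh color `d`, and all pieces share the colors below `d`. A connected set
  -- containing `m` has `m` as its centre; on any other, `branch m` is constant, so it lies in one
  -- piece.
  ranked-remove : ∀ {d X} m → (∀ i → Ranked d (λ w → X w × w ≢ m × branch m w ≡ i)) → Ranked (suc d) X
  ranked-remove {d} {X} m parts = col , bound , centre
    where
    part : V → V → ℕ
    part i = proj₁ (parts i)

    col : V → ℕ
    col w with w ≟ m
    ... | yes _ = d
    ... | no _  = part (branch m w) w

    col-m : col m ≡ d
    col-m with m ≟ m
    ... | yes _   = refl
    ... | no m≢m = ⊥-elim (m≢m refl)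

    col-≢m : ∀ {w} → w ≢ m → col w ≡ part (branch m w) w
    col-≢m {w} w≢m with w ≟ m
    ... | yes w≡m = ⊥-elim (w≢m w≡m)
    ... | no _    = refl

    part< : ∀ {w} → X w → w ≢ m → part (branch m w) w < d
    part< {w} x w≢m = proj₁ (proj₂ (parts (branch m w))) (x , w≢m , refl)

    bound : ∀ {w} → X w → col w < suc d
    bound {w} x with w ≟ m
    ... | yes _   = ≤-refl
    ... | no w≢m = m<n⇒m<1+n (part< x w≢m)

    centre : ∀ S → ConnectedOn T S → (∀ {w} → w ∈ₛ S → X w) →
      ∃ λ v → v ∈ₛ S × (∀ w → w ∈ₛ S → col w ≡ col v → w ≡ v)
    centre S conn S⊆X with m ∈ₛ? S
    ... | yes m∈ = m , m∈ , m-only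
      where
      m-only : ∀ w → w ∈ₛ S → col w ≡ col m → w ≡ m
      m-only w w∈ eq with w ≟ m
      ... | yes w≡m = w≡m
      ... | no w≢m  = ⊥-elim (<-irrefl (trans eq col-m) (part< (S⊆X w∈) w≢m))
    ... | no m∉ = v , v∈ , λ w w∈ eq → v-only w w∈ (trans (sym (col-part w∈)) (trans eq (col-part v∈)))
      where
      s = proj₁ (proj₁ conn)
      ≢m : ∀ {w} → w ∈ₛ S → w ≢ m
      ≢m w∈ refl = m∉ w∈
      same : ∀ {w} → w ∈ₛ S → branch m w ≡ branch m s
      same w∈ = connected-constant (branch m) conn
        (λ x∈ y∈ e → branch-adjacent e (≢m x∈) (≢m y∈)) w∈ (proj₂ (proj₁ conn))
      col-part : ∀ {w} → w ∈ₛ S → col w ≡ part (branch m s) w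
      col-part {w} w∈ = trans (col-≢m (≢m w∈)) (cong (λ i → part i w) (same w∈))
      part-centre = proj₂ (proj₂ (parts (branch m s))) S conn (λ w∈ → S⊆X w∈ , ≢m w∈ , same w∈)
      v = proj₁ part-centre
      v∈ = proj₁ (proj₂ part-centre)
      v-only = proj₂ (proj₂ part-centre)

  child? : ∀ u v → Dec (Child u v)
  child? u v = ≡-dec _≟_ (toRoot u) (u ∷ toRoot v)

  Below : V → V → Set
  Below u w = u ∈ toRoot w

  Between : V → V → V → Set
  Between a c w = Below a w × ¬ Below c w

  -- The index of a nonempty piece is either `m`, for the vertices not below `m`, or a child of `m`.
  ranked-remove-child : ∀ {d X} m → Ranked d (λ w → X w × ¬ Below m w) →
    (∀ {u} → Child u m → Ranked d (λ w → X w × Below u w)) → Ranked (suc d) X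
  ranked-remove-child {d} {X} m above below = ranked-remove m part
    where
    part : ∀ i → Ranked d (λ w → X w × w ≢ m × branch m w ≡ i)
    part i with i ≟ m
    ... | yes refl = ranked-⊆ ≤-refl (λ {w} (x , w≢m , eq) → x , branch-outside w w≢m eq) above
    ... | no i≢m with child? i m
    ...   | yes c = ranked-⊆ ≤-refl
                      (λ { {w} (x , _ , refl) → x , proj₂ (branch-below w i≢m) }) (below c)
    ...   | no ¬c = ranked-∅ λ { {w} (_ , _ , refl) → ¬c (proj₁ (branch-below w i≢m)) }

  -- Upper bound: colorings from a weight superadditive on siblings

  module Weighted (b : V → ℕ) (b-positive : ∀ v → 0 < b v)
    (b-child : ∀ {u v} → Child u v → b u < b v)
    (b-siblings : ∀ {u u′ v} → Child u v → Child u′ v → u ≢ u′ → b u + b u′ < b v) where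

    b-ancestor : ∀ {a c} → a ∈ toRoot c → a ≡ c ⊎ b c < b a
    b-ancestor {a} {c} = go (toRoot c) refl
      where
      go : ∀ {c} xs → toRoot c ≡ xs → a ∈ xs → a ≡ c ⊎ b c < b a
      go {c} (x ∷ xs) eq a∈ with toRoot-cases c
      go {c} (x ∷ xs) eq a∈ | inj₁ e with trans (sym e) eq | a∈
      ... | refl | here a≡c = inj₁ a≡c
      go {c} (x ∷ xs) eq a∈ | inj₂ (z , e) with trans (sym e) eq | a∈
      ... | refl | here a≡c = inj₁ a≡c
      ... | refl | there a∈xs with go xs refl a∈xs
      ...   | inj₁ refl = inj₂ (b-child e)
      ...   | inj₂ lt   = inj₂ (≤-trans (b-child e) (<⇒≤ lt))

    b-antitone : ∀ {a c} → a ∈ toRoot c → b c ≤ b a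
    b-antitone a∈ with b-ancestor a∈
    ... | inj₁ refl = ≤-refl
    ... | inj₂ lt   = <⇒≤ lt

    -- Descend to a child of weight at least `t` while there is one. The fuel `b v` suffices because
    -- `b` drops at every step.
    lowest-heavy : ∀ t v → t ≤ b v →
      ∃ λ m → Below v m × t ≤ b m × (∀ {u} → Child u m → b u < t)
    lowest-heavy t v = go (b v) v ≤-refl
      where
      go : ∀ fuel v → b v ≤ fuel → t ≤ b v →
        ∃ λ m → Below v m × t ≤ b m × (∀ {u} → Child u m → b u < t)
      go zero v b≤0 _ = ⊥-elim (n≮0 (<-≤-trans (b-positive v) b≤0))
      go (suc fuel) v b≤ t≤ with any? (λ u → child? u v ×-dec (t ≤? b u))
      ... | no none = v , self∈toRoot v , t≤ , λ c → ≰⇒> λ t≤u → none (_ , c , t≤u)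
      ... | yes (u , c , t≤u) with go fuel u (s≤s⁻¹ (<-≤-trans (b-child c) b≤)) t≤u
      ...   | m , u-m , t≤m , light = m , ancestor-trans (child⇒ancestor c) u-m , t≤m , light

    -- Climb from `c` to the first parent of weight at least `t`; since `t ≤ b a`, it is met no
    -- later than `a`.
    crossing : ∀ t {a c} → Below a c → b c < t → t ≤ b a →
      ∃ λ m → ∃ λ m′ → Child m′ m × Below a m × Below m′ c × b m′ < t × t ≤ b m
    crossing t {a} {c} a∈ bc<t t≤ba = go (toRoot c) refl a∈ bc<t (self∈toRoot c)
      where
      go : ∀ {w} xs → toRoot w ≡ xs → a ∈ xs → b w < t → Below w c →
        ∃ λ m → ∃ λ m′ → Child m′ m × Below a m × Below m′ c × b m′ < t × t ≤ b m
      go {w} (x ∷ xs) eq a∈ bw<t w-c with toRoot-cases w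
      go {w} (x ∷ xs) eq a∈ bw<t w-c | inj₁ e with trans (sym e) eq | a∈
      ... | refl | here refl = ⊥-elim (<-irrefl refl (<-≤-trans bw<t t≤ba))
      go {w} (x ∷ xs) eq a∈ bw<t w-c | inj₂ (z , e) with trans (sym e) eq | a∈
      ... | refl | here refl = ⊥-elim (<-irrefl refl (<-≤-trans bw<t t≤ba))
      ... | refl | there a∈z with b z <? t
      ...   | yes bz<t = go xs refl a∈z bz<t (ancestor-trans (child⇒ancestor e) w-c)
      ...   | no bz≮t  = z , w , e , a∈z , w-c , bw<t , ≮⇒≥ bz≮t

    -- The sibling `m′` already uses up `b c` of a total below `b c + t`, which leaves less than `t`
    -- for `u`.
    light-sibling : ∀ {a c m m′ u} t → Below a m → Below m′ c → Child m′ m → Child u m → u ≢ m′ →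
      b a < b c + t → b u < t
    light-sibling {a} {c} {m} {m′} {u} t a-m m′-c c′ cu u≢m′ ba< = +-cancelˡ-< (b c) (b u) t (begin-strict
      b c + b u   ≤⟨ +-monoˡ-≤ (b u) (b-antitone m′-c) ⟩
      b m′ + b u  <⟨ b-siblings c′ cu (u≢m′ ∘ sym) ⟩
      b m         ≤⟨ b-antitone a-m ⟩
      b a         <⟨ ba< ⟩
      b c + t     ∎)
      where open ≤-Reasoning

    BelowRanked BetweenRanked : ℕ → Set
    BelowRanked j   = ∀ v → b v < 2 ^ j → Ranked (double j) (Below v)
    BetweenRanked j = ∀ a c → Below a c → b a < b c + 2 ^ j → Ranked (suc (double j)) (Between a c)

    -- The part not below `m` falls under `BetweenRanked j`, because `2 ^ suc j` is at most
    -- `b m + 2 ^ j`. The removed vertex adds one color to its 2j + 1.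
    below-suc : ∀ j → BelowRanked j → BetweenRanked j → BelowRanked (suc j)
    below-suc j below between v bv< with b v <? 2 ^ j
    ... | yes lt = ranked-⊆ (m≤n⇒m≤1+n (m≤n⇒m≤1+n ≤-refl)) id (below v lt)
    ... | no ≮   with m , v-m , heavy , light ← lowest-heavy (2 ^ j) v (≮⇒≥ ≮) =
      ranked-remove-child m
        (between v m v-m (<-≤-trans bv< (≤-trans (≤-reflexive (2^suc j)) (+-monoˡ-≤ (2 ^ j) heavy))))
        (λ c → ranked-⊆ (m≤n⇒m≤1+n ≤-refl) proj₂ (below _ (light c)))

    -- Three kinds of pieces remain: between `a` and `m`, between `m′` and `c`, and below the other
    -- children of `m`. The last kind needs `BelowRanked` already at `suc j`, which fixes the order
    -- of the induction.
    between-suc : ∀ j → BelowRanked (suc j) → BetweenRanked j → BetweenRanked (suc j)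
    between-suc j below between a c a-c ba< with b a <? b c + 2 ^ j
    ... | yes lt = ranked-⊆ (s≤s (m≤n⇒m≤1+n (m≤n⇒m≤1+n ≤-refl))) id (between a c a-c lt)
    ... | no ≮   with m , m′ , c′ , a-m , m′-c , m′< , ≤m ←
                        crossing (b c + 2 ^ j) a-c (m<m+n (b c) (m^n>0 2 j)) (≮⇒≥ ≮) =
      ranked-remove-child m
        (ranked-⊆ (m≤n⇒m≤1+n ≤-refl) (λ ((a-w , _) , ¬m-w) → a-w , ¬m-w) (between a m a-m top))
        branches
      where
      open ≤-Reasoning
      top : b a < b m + 2 ^ j
      top = begin-strict
        b a                       <⟨ ba< ⟩
        b c + 2 ^ suc j           ≡⟨ cong (b c +_) (2^suc j) ⟩
        b c + (2 ^ j + 2 ^ j)     ≡⟨ sym (+-assoc (b c) _ _) ⟩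
        b c + 2 ^ j + 2 ^ j       ≤⟨ +-monoˡ-≤ (2 ^ j) ≤m ⟩
        b m + 2 ^ j               ∎
      branches : ∀ {u} → Child u m → Ranked (suc (suc (double j))) (λ w → Between a c w × Below u w)
      branches {u} cu with u ≟ m′
      ... | yes refl = ranked-⊆ (m≤n⇒m≤1+n ≤-refl) (λ ((_ , ¬c-w) , u-w) → u-w , ¬c-w)
                         (between u c m′-c m′<)
      ... | no u≢m′  = ranked-⊆ ≤-refl proj₂
                         (below u (light-sibling (2 ^ suc j) a-m m′-c c′ cu u≢m′ ba<))

    ranked : ∀ j → BelowRanked j × BetweenRanked j
    -- The first claim is vacuous since weights are positive. In the second, `b a ≤ b c` forces
    -- `a ≡ c`, so the part is empty.
    ranked zero = (λ v bv< → ⊥-elim (<-irrefl refl (<-≤-trans bv< (b-positive v)))) , between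
      where
      between : BetweenRanked zero
      between a c a-c ba< with b-ancestor a-c
      ... | inj₁ refl = ranked-∅ λ (a-w , ¬a-w) → ¬a-w a-w
      ... | inj₂ lt   = ⊥-elim (<-irrefl refl (<-≤-trans ba< (≤-trans (≤-reflexive (+-comm (b c) 1)) lt)))
    ranked (suc j) =
      let below , between = ranked j
          below′ = below-suc j below between
      in  below′ , between-suc j below′ between

    centered-coloring : ∀ j → b root < 2 ^ j → ∃ λ (col : V → Fin (double j)) → IsCenteredColoring T col
    centered-coloring j b< =
      (λ w → fromℕ< (bound (root∈toRoot w))) , λ S conn →
        let v , v∈ , only = centre S conn (λ _ → root∈toRoot _)
        in  v , v∈ , λ w w∈ eq → only w w∈ (fromℕ<-injective _ _ _ _ eq)
      where
      root-ranked = proj₁ (ranked j) root b<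
      bound       = proj₁ (proj₂ root-ranked)
      centre      = proj₂ (proj₂ root-ranked)

-- Auxiliary facts on lists

unique⇒lookup-injective : ∀ {A : Set} {xs : List A} → Unique xs → ∀ i j → lookup xs i ≡ lookup xs j → i ≡ j
unique⇒lookup-injective (_ ∷ _) zero    zero    _  = refl
unique⇒lookup-injective (a ∷ _) zero    (suc j) eq = ⊥-elim (All.lookup a (∈-lookup j) eq)
unique⇒lookup-injective (a ∷ _) (suc i) zero    eq = ⊥-elim (All.lookup a (∈-lookup i) (sym eq))
unique⇒lookup-injective (_ ∷ u) (suc i) (suc j) eq = cong suc (unique⇒lookup-injective u i j eq)

unique-++⁻ : ∀ {A : Set} (xs : List A) {ys} → Unique (xs ++ ys) → Unique xs × Disjoint xs ys
unique-++⁻ [] u = [] , λ ()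
unique-++⁻ (x ∷ xs) (a ∷ u) with ux , d ← unique-++⁻ xs u =
  AllP.++⁻ˡ xs a ∷ ux ,
  λ { (here refl , y∈) → All.lookup a (∈-++⁺ʳ xs y∈) refl ; (there x∈ , y∈) → d (x∈ , y∈) }

unique-reverse : ∀ {A : Set} (xs : List A) → Unique xs → Unique (reverse xs)
unique-reverse {A} xs = Perm.Unique-resp-↭ (setoid A) (↭-sym (setoid A) (Perm.↭-reverse (setoid A) xs))

module _ {A : Set} {R : Rel A 0ℓ} where

  linked-++-replace : ∀ xs {v ys zs} → Linked R (xs ++ v ∷ ys) → Linked R (v ∷ zs) → Linked R (xs ++ v ∷ zs)
  linked-++-replace []           _       l′ = l′
  linked-++-replace (x ∷ [])     (r ∷ l) l′ = r ∷ l′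
  linked-++-replace (x ∷ y ∷ xs) (r ∷ l) l′ = r ∷ linked-++-replace (y ∷ xs) l l′

  linked-reverse : (∀ {a b} → R a b → R b a) → ∀ xs {v ys} → Linked R (xs ++ v ∷ ys) → Linked R (v ∷ reverse xs)
  linked-reverse R-sym []       _ = [-]
  linked-reverse R-sym (x ∷ xs) l = go xs l [-]
    where
    go : ∀ xs {x v ys acc} → Linked R (x ∷ xs ++ v ∷ ys) → Linked R (x ∷ acc) → Linked R (v ∷ (xs ʳ++ (x ∷ acc)))
    go []       (r ∷ _) l′ = R-sym r ∷ l′
    go (y ∷ xs) (r ∷ l) l′ = go xs l (R-sym r ∷ l′)

-- Lower bound: ternary codes, with `rotate` as addition of 1 in ℤ/3

rotate : Fin 3 → Fin 3
rotate zero             = suc zero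
rotate (suc zero)       = suc (suc zero)
rotate (suc (suc zero)) = zero

rotate-injective : ∀ {i j} → rotate i ≡ rotate j → i ≡ j
rotate-injective {i} {j} eq = trans (sym (rotate³ i)) (trans (cong (rotate ∘ rotate) eq) (rotate³ j))
  where
  rotate³ : ∀ i → rotate (rotate (rotate i)) ≡ i
  rotate³ zero             = refl
  rotate³ (suc zero)       = refl
  rotate³ (suc (suc zero)) = refl

module Coded {n : ℕ} (T : Graph n) (tree : IsTree T) {k : ℕ}
  (col : Fin n → Fin k) (lin : IsLinearColoring T col) where
  open Rooted T tree

  -- zs lists the vertices strictly below v on the way up to v from some descendant.
  Hangs : V → List V → Set
  Hangs v zs = ∃ λ w → toRoot w ≡ zs ++ toRoot v

  hangs-[] : ∀ {v} → Hangs v []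
  hangs-[] {v} = v , refl

  hangs-∷ : ∀ {v} zs → Hangs v zs → ∃ λ w → toRoot w ≡ zs ++ v ∷ drop 1 (toRoot v)
  hangs-∷ {v} zs (w , eq) = w , trans eq (cong (zs ++_) (toRoot-∷ v))

  hangs-unique : ∀ {v} zs → Hangs v zs → Unique zs × v ∉ zs
  hangs-unique {v} zs (w , eq) with u , d ← unique-++⁻ zs (subst Unique eq (toRoot-unique w)) =
    u , λ v∈ → d (v∈ , self∈toRoot v)

  Bend : V → List V → List V → V → Set
  Bend v zs zs′ x = x ≡ v ⊎ x ∈ zs ⊎ x ∈ zs′

  -- Climbing along `zs` to `v` and descending along `reverse zs′` is a path, to which the linear
  -- coloring applies.
  bend-centre : ∀ {v zs zs′} → Hangs v zs → Hangs v zs′ → Disjoint zs zs′ →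
    ∃ λ x → Bend v zs zs′ x × (∀ w → Bend v zs zs′ w → col w ≡ col x → w ≡ x)
  bend-centre {v} {zs} {zs′} h h′ dis =
    let x , x∈ , only = lin path (nonempty zs , path-unique , path-linked)
    in  x , from x∈ , λ w w-in → only w (to w-in)
    where
    path = zs ++ v ∷ reverse zs′
    nonempty : ∀ xs {x ys} → 0 < length (xs ++ x ∷ ys)
    nonempty []      = s≤s z≤n
    nonempty (_ ∷ _) = s≤s z≤n
    from : ∀ {x} → x ∈ path → Bend v zs zs′ x
    from x∈ with ∈-++⁻ zs x∈
    ... | inj₁ x∈zs          = inj₂ (inj₁ x∈zs)
    ... | inj₂ (here x≡v)    = inj₁ x≡v
    ... | inj₂ (there x∈zs′) = inj₂ (inj₂ (AnyP.reverse⁻ x∈zs′))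
    to : ∀ {x} → Bend v zs zs′ x → x ∈ path
    to (inj₁ refl)        = ∈-++⁺ʳ zs (here refl)
    to (inj₂ (inj₁ x∈))   = ∈-++⁺ˡ x∈
    to (inj₂ (inj₂ x∈))   = ∈-++⁺ʳ zs (there (AnyP.reverse⁺ x∈))
    path-unique : Unique path
    path-unique with u , v∉ ← hangs-unique zs h | u′ , v∉′ ← hangs-unique zs′ h′ =
      UniqueP.++⁺ u (∉⇒All≢ (v∉′ ∘ AnyP.reverse⁻) ∷ unique-reverse zs′ u′)
        λ { (x∈ , here refl) → v∉ x∈ ; (x∈ , there x∈′) → dis (x∈ , AnyP.reverse⁻ x∈′) }
    hangs-linked : ∀ zs → Hangs v zs → Linked (Adj T) (zs ++ v ∷ drop 1 (toRoot v))
    hangs-linked zs h = let w , eq = hangs-∷ zs h in subst (Linked (Adj T)) eq (simple-linked (toRoot-simple w))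
    path-linked : Linked (Adj T) path
    path-linked = linked-++-replace zs (hangs-linked zs h) (linked-reverse (Graph.sym T) zs′ (hangs-linked zs′ h′))

  Code : Set
  Code = Fin k → Fin 3

  -- The coordinate is explicit because functions with equal values need not be propositionally
  -- equal.
  _#_ : Code → Code → Set
  f # g = ∃ λ c → f c ≢ g c

  -- All that is remembered of the walk: a color met exactly once was raised once, by 1 or 2. A
  -- color met several times may sum to anything.
  record Encodes (f : Code) (zs : List V) : Set where
    field
      absent : ∀ c → (∀ x → x ∈ zs → col x ≢ c) → f c ≡ zero
      single : ∀ x → x ∈ zs → (∀ w → w ∈ zs → col w ≡ col x → w ≡ x) → f (col x) ≢ zero
  open Encodes

  module _ (ρ : Fin 3 → Fin 3) where

    bump : Fin k → Code → Code
    bump c f c′ with c′ ≟ c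
    ... | yes _ = ρ (f c′)
    ... | no _  = f c′

    bump-same : ∀ c f → bump c f c ≡ ρ (f c)
    bump-same c f with c ≟ c
    ... | yes _  = refl
    ... | no c≢c = ⊥-elim (c≢c refl)

    bump-other : ∀ {c c′} f → c′ ≢ c → bump c f c′ ≡ f c′
    bump-other {c} {c′} f c′≢c with c′ ≟ c
    ... | yes c′≡c = ⊥-elim (c′≢c c′≡c)
    ... | no _     = refl

    bump-# : (∀ {i j} → ρ i ≡ ρ j → i ≡ j) → ∀ c {f g} → f # g → bump c f # bump c g
    bump-# ρ-injective c {f} {g} (c′ , ne) = c′ , ne′
      where
      ne′ : bump c f c′ ≢ bump c g c′
      ne′ with c′ ≟ c
      ... | yes _ = ne ∘ ρ-injective
      ... | no _  = ne

    -- If `v` alone has its color, that coordinate was zero and becomes `ρ zero`. If the unique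
    -- vertex `x` lies in `zs`, then `v` has another color and the coordinate of `x` is untouched.
    bump-encodes : ρ zero ≢ zero → ∀ {v f} zs → v ∉ zs → Encodes f zs → Encodes (bump (col v) f) (zs ∷ʳ v)
    bump-encodes ρ0≢0 {v} {f} zs v∉ enc .absent c none =
      trans (bump-other f (none v (∈-++⁺ʳ zs (here refl)) ∘ sym)) (absent enc c λ x x∈ → none x (∈-++⁺ˡ x∈))
    bump-encodes ρ0≢0 {v} {f} zs v∉ enc .single x x∈ only with ∈-++⁻ zs x∈
    ... | inj₂ (here refl) = λ eq → ρ0≢0 (trans (sym (trans (bump-same (col v) f) (cong ρ f≡0))) eq)
      where
      f≡0 : f (col v) ≡ zero
      f≡0 = absent enc (col v) λ w w∈ eq → v∉ (subst (_∈ zs) (only w (∈-++⁺ˡ w∈) eq) w∈)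
    ... | inj₁ x∈zs = λ eq → single enc x x∈zs (λ w w∈ → only w (∈-++⁺ˡ w∈))
                        (trans (sym (bump-other f x≢v)) eq)
      where
      x≢v : col x ≢ col v
      x≢v eq = v∉ (subst (_∈ zs) (sym (only v (∈-++⁺ʳ zs (here refl)) (sym eq))) x∈zs)

  Family : (List V → Set) → ℕ → Set
  Family G M = ∃ λ (fs : List Code) → length fs ≡ M × AllPairs _#_ fs × All (λ f → ∃ λ zs → G zs × Encodes f zs) fs

  zero-encodes : Encodes (λ _ → zero) []
  zero-encodes .absent _ _ = refl
  zero-encodes .single _ ()

  emptySlot : Family (_≡ []) 1
  emptySlot = (λ _ → zero) ∷ [] , refl , [] ∷ [] , ([] , refl , zero-encodes) ∷ []

  -- Models lists that are empty or end in `v`. The first half lets them be used one level up and is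
  -- vacuous at the root; the second keeps lists under different siblings disjoint.
  Rising : V → List V → Set
  Rising v zs = (∀ {p} → Child v p → Hangs p zs) × All (λ x → v ∈ toRoot x) zs

  module _ {v : V} where

    left right : Code → Code
    left  = bump rotate (col v)
    right = bump (rotate ∘ rotate) (col v)

    rising-[] : Rising v []
    rising-[] = (λ _ → hangs-[]) , []

    rising-∷ʳ : ∀ {zs} → Hangs v zs → Rising v (zs ∷ʳ v)
    rising-∷ʳ {zs} (w , eq) =
      (λ {p} c → w , trans eq (trans (cong (zs ++_) c) (sym (∷ʳ-++ zs v (toRoot p))))) ,
      AllP.++⁺ (All.tabulate λ x∈ → above x∈) (self∈toRoot v ∷ [])
      where
      above : ∀ {x} → x ∈ zs → v ∈ toRoot x
      above {x} x∈ with as , bs , refl ← ∈-∃++ x∈ =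
        subst (v ∈_) (sym (toRoot-suffix as (trans eq (++-assoc as (x ∷ bs) (toRoot v)))))
          (there (∈-++⁺ʳ bs (self∈toRoot v)))

    -- Compares the position at `v` itself, whose code is zero, with one further down: the color of
    -- the centre of the path `zs ∷ʳ v` has a nonzero coordinate in the bumped code.
    zero-#-bump : ∀ ρ → ρ zero ≢ zero → ∀ {f zs} → Hangs v zs → Encodes f zs → (λ _ → zero) # bump ρ (col v) f
    zero-#-bump ρ ρ0≢0 {f} {zs} h enc with bend-centre h hangs-[] (λ ())
    ... | x , x-in , only = col x , single (bump-encodes ρ ρ0≢0 zs (proj₂ (hangs-unique zs h)) enc) x (to x-in)
                                       (λ w w∈ → only w (from w∈)) ∘ sym
      where
      to : ∀ {x} → Bend v zs [] x → x ∈ zs ∷ʳ v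
      to (inj₁ refl)        = ∈-++⁺ʳ zs (here refl)
      to (inj₂ (inj₁ x∈))   = ∈-++⁺ˡ x∈
      from : ∀ {x} → x ∈ zs ∷ʳ v → Bend v zs [] x
      from x∈ with ∈-++⁻ zs x∈
      ... | inj₁ x∈zs       = inj₂ (inj₁ x∈zs)
      ... | inj₂ (here x≡v) = inj₁ x≡v

    -- If the centre is `v`, its coordinate is 1 on one side and 2 on the other. Otherwise its color
    -- is missing from `v` and from the opposite list, so the coordinate is nonzero on one side and
    -- zero on the other.
    left-#-right : ∀ {f g zs zs′} → Hangs v zs → Hangs v zs′ → Disjoint zs zs′ →
      Encodes f zs → Encodes g zs′ → left f # right g
    left-#-right {f} {g} {zs} {zs′} h h′ dis ef eg with bend-centre h h′ dis
    ... | x , inj₁ refl , only = col v , λ eq → 1≢2 (trans (sym left≡1) (trans eq right≡2))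
      where
      1≢2 : rotate zero ≢ rotate (rotate zero)
      1≢2 ()
      left≡1 : left f (col v) ≡ rotate zero
      left≡1 = trans (bump-same _ (col v) f) (cong rotate (absent ef (col v) λ w w∈ eq →
        proj₂ (hangs-unique zs h) (subst (_∈ zs) (only w (inj₂ (inj₁ w∈)) eq) w∈)))
      right≡2 : right g (col v) ≡ rotate (rotate zero)
      right≡2 = trans (bump-same _ (col v) g) (cong (rotate ∘ rotate) (absent eg (col v) λ w w∈ eq →
        proj₂ (hangs-unique zs′ h′) (subst (_∈ zs′) (only w (inj₂ (inj₂ w∈)) eq) w∈)))
    ... | x , inj₂ (inj₁ x∈) , only = col x , λ eq →
      single ef x x∈ (λ w w∈ → only w (inj₂ (inj₁ w∈)))
        (trans (sym (bump-other _ f x≢v)) (trans eq (trans (bump-other _ g x≢v) g≡0)))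
      where
      x≢v : col x ≢ col v
      x≢v eq = proj₂ (hangs-unique zs h) (subst (_∈ zs) (sym (only v (inj₁ refl) (sym eq))) x∈)
      g≡0 : g (col x) ≡ zero
      g≡0 = absent eg (col x) λ w w∈ eq → dis (x∈ , subst (_∈ zs′) (only w (inj₂ (inj₂ w∈)) eq) w∈)
    ... | x , inj₂ (inj₂ x∈) , only = col x , λ eq →
      single eg x x∈ (λ w w∈ → only w (inj₂ (inj₂ w∈)))
        (trans (sym (bump-other _ g x≢v)) (trans (sym eq) (trans (bump-other _ f x≢v) f≡0)))
      where
      x≢v : col x ≢ col v
      x≢v eq = proj₂ (hangs-unique zs′ h′) (subst (_∈ zs′) (sym (only v (inj₁ refl) (sym eq))) x∈)
      f≡0 : f (col x) ≡ zero
      f≡0 = absent ef (col x) λ w w∈ eq → dis (subst (_∈ zs) (only w (inj₂ (inj₁ w∈)) eq) w∈ , x∈)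

    -- The zero code stands for the position at `v`; the other codes come from its two slots. Within
    -- one slot codes stay apart because the bump is injective.
    combine : ∀ {G G′ M M′} → (∀ {zs} → G zs → Hangs v zs) → (∀ {zs} → G′ zs → Hangs v zs) →
      (∀ {zs zs′} → G zs → G′ zs′ → Disjoint zs zs′) →
      Family G M → Family G′ M′ → Family (Rising v) (suc (M + M′))
    combine hangs hangs′ disjoint (fs , refl , dfs , efs) (gs , refl , dgs , egs) =
      (λ _ → zero) ∷ map left fs ++ map right gs
      , cong suc (trans (length-++ (map left fs)) (cong₂ _+_ (length-map left fs) (length-map right gs)))
      , AllP.++⁺ (AllP.map⁺ (All.map (λ (zs , g , e) → zero-#-bump rotate (λ ()) (hangs g) e) efs))
                 (AllP.map⁺ (All.map (λ (zs , g , e) → zero-#-bump (rotate ∘ rotate) (λ ()) (hangs′ g) e) egs))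
        ∷ AllPairsP.++⁺
            (AllPairsP.map⁺ (AllPairs.map (bump-# _ rotate-injective (col v)) dfs))
            (AllPairsP.map⁺ (AllPairs.map (bump-# _ (rotate-injective ∘ rotate-injective) (col v)) dgs))
            (AllP.map⁺ (All.map (λ (_ , g , e) → AllP.map⁺ (All.map (λ (_ , g′ , e′) →
              left-#-right (hangs g) (hangs′ g′) (disjoint g g′) e e′) egs)) efs))
      , ([] , rising-[] , zero-encodes)
        ∷ AllP.++⁺
            (AllP.map⁺ (All.map (λ (zs , g , e) → zs ∷ʳ v , rising-∷ʳ (hangs g) ,
              bump-encodes rotate (λ ()) zs (proj₂ (hangs-unique zs (hangs g))) e) efs))
            (AllP.map⁺ (All.map (λ (zs , g , e) → zs ∷ʳ v , rising-∷ʳ (hangs′ g) ,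
              bump-encodes (rotate ∘ rotate) (λ ()) zs (proj₂ (hangs-unique zs (hangs′ g))) e) egs))

  -- An empty slot counts as one position, with the empty list and the zero code.
  codes : ∀ {v m} → Binary v m → Family (Rising v) (1 + (m + m))
  codes leaf = combine {G = _≡ []} {G′ = _≡ []} (λ { refl → hangs-[] }) (λ { refl → hangs-[] })
                 (λ { refl _ (() , _) }) emptySlot emptySlot
  codes {v} (one {u} {m} c t) =
    subst (Family (Rising v)) (cong suc (trans (+-comm _ 1) (cong suc (sym (+-suc m m)))))
      (combine {G = Rising u} {G′ = _≡ []} (λ r → proj₁ r c) (λ { refl → hangs-[] })
         (λ { _ refl (_ , ()) }) (codes t) emptySlot)
  codes {v} (two {u} {u′} {m} {m′} c c′ u≢u′ t t′) =
    subst (Family (Rising v))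
      (solve 2 (λ x y → con 1 :+ (con 1 :+ (x :+ x) :+ (con 1 :+ (y :+ y)))
                     := con 1 :+ (con 1 :+ (x :+ y) :+ (con 1 :+ (x :+ y)))) refl m m′)
      (combine {G = Rising u} {G′ = Rising u′} (λ r → proj₁ r c) (λ r → proj₁ r c′)
         (λ r r′ (x∈ , x∈′) → u≢u′ (siblings-disjoint c c′ (All.lookup (proj₂ r) x∈) (All.lookup (proj₂ r′) x∈′)))
         (codes t) (codes t′))
    where open +-*-Solver

  -- Codes that differ at a coordinate have different images in `Fin (3 ^ k)` under `funToFin`.
  binary-bound : ∀ {v m} → Binary v m → m + m < 3 ^ k
  binary-bound {m = m} t with codes t
  ... | fs , len , distinct , _ = subst (_≤ 3 ^ k) (trans (length-map funToFin fs) len)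
    (injective⇒≤ (λ {i} {j} → unique⇒lookup-injective unique i j))
    where
    unique : Unique (map funToFin fs)
    unique = AllPairsP.map⁺ (AllPairs.map (λ {f} {g} (c , ne) eq → ne (trans (sym (finToFun-funToFin f c))
      (trans (cong (λ i → finToFun i c) eq) (finToFun-funToFin g c)))) distinct)

-- Combining the two bounds

Maximal : (ℕ → Set) → ℕ → Set
Maximal Q m = Q m × (∀ m′ → Q m′ → m′ ≤ m)

-- `Q` is not assumed decidable. If `m` is not maximal, a larger value satisfies `Q` and the
-- distance `d` to the bound shrinks.
¬¬-maximum : ∀ (Q : ℕ → Set) {m N} → Q m → (∀ m′ → Q m′ → m′ ≤ N) → ¬ ¬ ∃ (Maximal Q)
¬¬-maximum Q {N = N} q bound = go N q (λ m′ q′ → ≤-trans (bound m′ q′) (m≤m+n N _))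
  where
  go : ∀ d {m} → Q m → (∀ m′ → Q m′ → m′ ≤ d + m) → ¬ ¬ ∃ (Maximal Q)
  go zero    q bound none = none (_ , q , bound)
  go (suc d) {m} q bound none = none (m , q , λ m′ q′ → ≮⇒≥ λ m<m′ →
    go d q′ (λ m″ q″ → ≤-trans (bound m″ q″) (≤-trans (≤-reflexive (sym (+-suc d m))) (+-monoʳ-≤ d m<m′))) none)

-- The power is doubled exactly when the argument reaches it. The rounding loss of at most a factor
-- 2 is absorbed by `m + m` in `binary-bound`.
power-between : ∀ m → 0 < m → ∃ λ j → m < 2 ^ j × 2 ^ j ≤ m + m
power-between (suc zero)    _ = 1 , ≤-refl , ≤-refl
power-between (suc (suc m)) _ with power-between (suc m) (s≤s z≤n)
... | j , m< , ≤2m with suc (suc m) <? 2 ^ j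
...   | yes lt = j , lt , ≤-trans ≤2m (+-mono-≤ (n≤1+n (suc m)) (n≤1+n (suc m)))
...   | no ≮   = suc j , subst (suc (suc m) <_) (sym eq) (m<m+n _ (s≤s z≤n)) , ≤-reflexive eq
  where
  eq : 2 ^ suc j ≡ suc (suc m) + suc (suc m)
  eq = trans (2^suc j) (cong (λ x → x + x) (≤-antisym (≮⇒≥ ≮) m<))

double≡+ : ∀ j → double j ≡ j + j
double≡+ zero    = refl
double≡+ (suc j) = cong suc (trans (cong suc (double≡+ j)) (sym (+-suc j j)))

centered≤linear : ∀ {n} (T : Graph n) → IsTree T → ∀ {a k} → IsChiCen T a → IsChiLin T k → 2 ^ a ≤ 3 ^ (k + k)
centered≤linear {n} T tree {a} {k} (_ , a-min) ((col , lin) , _) =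
  -- The claim is decidable, so maximal binary subtrees need only exist up to double negation.
  decidable-stable (_ ≤? _) λ ≰ → weights λ w → ≰ (bounded w)
  where
  open Rooted T tree
  open Ranking T tree
  open Coded T tree col lin

  weights : ¬ ¬ (∀ v → ∃ (Maximal (Binary v)))
  -- Double negation commutes with a quantifier over the finitely many vertices.
  weights = sequence (RawMonad.rawApplicative ¬¬-Monad) λ v →
    ¬¬-maximum (Binary v) leaf λ m t → ≤-trans (m≤m+n m m) (<⇒≤ (binary-bound t))

  bounded : (∀ v → ∃ (Maximal (Binary v))) → 2 ^ a ≤ 3 ^ (k + k)
  bounded w = result (power-between (b root) (b-max leaf))
    where
    b : V → ℕ
    b v = proj₁ (w v)
    largest : ∀ v → Binary v (b v)
    largest v = proj₁ (proj₂ (w v))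
    b-max : ∀ {v m} → Binary v m → m ≤ b v
    b-max {v} = proj₂ (proj₂ (w v)) _

    open Weighted b (λ v → b-max leaf) (λ c → b-max (one c (largest _)))
      (λ c c′ u≢u′ → b-max (two c c′ u≢u′ (largest _) (largest _)))

    result : (∃ λ j → b root < 2 ^ j × 2 ^ j ≤ b root + b root) → 2 ^ a ≤ 3 ^ (k + k)
    result (j , b< , ≤2b) = begin
      2 ^ a           ≤⟨ ^-monoʳ-≤ 2 (≮⇒≥ λ lt → a-min _ lt (centered-coloring j b<)) ⟩
      2 ^ double j    ≡⟨ trans (cong (2 ^_) (double≡+ j)) (^-distribˡ-+-* 2 j j) ⟩
      2 ^ j * 2 ^ j   ≤⟨ *-mono-≤ 2^j≤3^k 2^j≤3^k ⟩
      3 ^ k * 3 ^ k   ≡⟨ sym (^-distribˡ-+-* 3 k k) ⟩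
      3 ^ (k + k)     ∎
      where
      open ≤-Reasoning
      2^j≤3^k : 2 ^ j ≤ 3 ^ k
      2^j≤3^k = ≤-trans ≤2b (<⇒≤ (binary-bound (largest root)))

-- Numerical part: 2 is a lower bound for log_φ 3

2*lucas-suc : ∀ n → 2 * lucas (suc n) ≡ lucas n + 5 * fib n
2*lucas-suc zero          = refl
2*lucas-suc (suc zero)    = refl
2*lucas-suc (suc (suc n)) = trans (*-distribˡ-+ 2 (lucas (suc (suc n))) (lucas (suc n)))
  (trans (cong₂ _+_ (2*lucas-suc (suc n)) (2*lucas-suc n))
    (solve 4 (λ p q r s → p :+ con 5 :* q :+ (r :+ con 5 :* s) := p :+ r :+ con 5 :* (q :+ s)) refl
       (lucas (suc n)) (fib (suc n)) (lucas n) (fib n)))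
  where open +-*-Solver

-- Together with `2*lucas-suc`, this splits φ · φ^n into its √5-part and its rational part.
2*fib-suc : ∀ n → 2 * fib (suc n) ≡ lucas n + fib n
2*fib-suc zero          = refl
2*fib-suc (suc zero)    = refl
2*fib-suc (suc (suc n)) = trans (*-distribˡ-+ 2 (fib (suc (suc n))) (fib (suc n)))
  (trans (cong₂ _+_ (2*fib-suc (suc n)) (2*fib-suc n))
    (solve 4 (λ p q r s → p :+ q :+ (r :+ s) := p :+ r :+ (q :+ s)) refl
       (lucas (suc n)) (fib (suc n)) (lucas n) (fib n)))
  where open +-*-Solver

-- An upper bound for 8 φ^n = 4 (L_n + F_n √5), by √5 < 9/4.
approx : ℕ → ℕ
approx n = 4 * lucas n + 9 * fib n

-- An integer form of φ² < 3; after doubling, the slack is `3 * lucas n + 7 * fib n`.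
approx-+2 : ∀ n → approx (2 + n) ≤ 3 * approx n
approx-+2 n = *-cancelˡ-≤ 2 (begin
  2 * (4 * (lucas (suc n) + lucas n) + 9 * (fib (suc n) + fib n))
    ≡⟨ solve 4 (λ p q r s → con 2 :* (con 4 :* (p :+ q) :+ con 9 :* (r :+ s))
         := con 4 :* (con 2 :* p) :+ con 8 :* q :+ (con 9 :* (con 2 :* r) :+ con 18 :* s)) refl
         (lucas (suc n)) (lucas n) (fib (suc n)) (fib n) ⟩
  4 * (2 * lucas (suc n)) + 8 * lucas n + (9 * (2 * fib (suc n)) + 18 * fib n)
    ≡⟨ cong₂ (λ p r → 4 * p + 8 * lucas n + (9 * r + 18 * fib n)) (2*lucas-suc n) (2*fib-suc n) ⟩
  4 * (lucas n + 5 * fib n) + 8 * lucas n + (9 * (lucas n + fib n) + 18 * fib n)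
    ≤⟨ m≤m+n _ (3 * lucas n + 7 * fib n) ⟩
  4 * (lucas n + 5 * fib n) + 8 * lucas n + (9 * (lucas n + fib n) + 18 * fib n) + (3 * lucas n + 7 * fib n)
    ≡⟨ solve 2 (λ q s → con 4 :* (q :+ con 5 :* s) :+ con 8 :* q
           :+ (con 9 :* (q :+ s) :+ con 18 :* s) :+ (con 3 :* q :+ con 7 :* s)
         := con 2 :* (con 3 :* (con 4 :* q :+ con 9 :* s))) refl (lucas n) (fib n) ⟩
  2 * (3 * approx n) ∎)
  where
  open ≤-Reasoning
  open +-*-Solver

approx≤ : ∀ a b → a < b + b → approx a ≤ 8 * 3 ^ b
approx≤ (suc (suc a)) (suc b) lt = begin
  approx (2 + a)      ≤⟨ approx-+2 a ⟩
  3 * approx a        ≤⟨ *-monoʳ-≤ 3 (approx≤ a b (s≤s⁻¹ (s≤s⁻¹ (subst (2 + a <_) (cong suc (+-suc b b)) lt)))) ⟩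
  3 * (8 * 3 ^ b)     ≡⟨ solve 1 (λ x → con 3 :* (con 8 :* x) := con 8 :* (con 3 :* x)) refl (3 ^ b) ⟩
  8 * 3 ^ suc b       ∎
  where
  open ≤-Reasoning
  open +-*-Solver
approx≤ zero       (suc b) _ = *-mono-≤ {8} ≤-refl (m^n>0 3 (suc b))
-- `approx 1` is 13, and 13 ≤ 24 = 8 · 3.
approx≤ (suc zero) (suc b) _ = ≤-trans (m≤n+m 13 11) (*-monoʳ-≤ 8 {3} {3 ^ suc b} (*-monoʳ-≤ 3 (m^n>0 3 b)))

-- Replaces √5 by 9/4, which is larger because 16 · 5 < 81.
gtSqrt5⇒< : ∀ u v w → GtSqrt5 u v w → 4 * w < 4 * u + 9 * v
gtSqrt5⇒< u v w (inj₁ w<u) = <-≤-trans (*-monoʳ-< 4 w<u) (m≤m+n _ _)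
gtSqrt5⇒< u v w (inj₂ (u≤w , sq)) = begin-strict
  4 * w                ≡⟨ cong (4 *_) (sym (m+[n∸m]≡n u≤w)) ⟩
  4 * (u + (w ∸ u))    ≡⟨ *-distribˡ-+ 4 u (w ∸ u) ⟩
  4 * u + 4 * (w ∸ u)  <⟨ +-monoʳ-< (4 * u) (≰⇒> λ le → <⇒≱ sq′ (*-mono-≤ le le)) ⟩
  4 * u + 9 * v        ∎
  where
  open ≤-Reasoning
  open +-*-Solver
  d = w ∸ u
  sq′ : (4 * d) * (4 * d) < (9 * v) * (9 * v)
  sq′ = begin-strict
    (4 * d) * (4 * d)  ≡⟨ solve 1 (λ x → (con 4 :* x) :* (con 4 :* x) := con 16 :* (x :^ 2)) refl d ⟩
    16 * d ^ 2         <⟨ *-monoʳ-< 16 sq ⟩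
    16 * (5 * v ^ 2)   ≤⟨ m≤m+n _ (v ^ 2) ⟩
    16 * (5 * v ^ 2) + v ^ 2
      ≡⟨ solve 1 (λ x → con 16 :* (con 5 :* (x :^ 2)) :+ x :^ 2 := (con 9 :* x) :* (con 9 :* x)) refl v ⟩
    (9 * v) * (9 * v)  ∎

2≤logφ3 : ∀ a b → UpperLogPhiOf3 a b → b + b ≤ a
2≤logφ3 a b (_ , gt) = ≮⇒≥ λ a<2b → <⇒≱ (gtSqrt5⇒< (lucas a) (fib a) _ gt)
  (≤-trans (approx≤ a b a<2b) (≤-reflexive (*-assoc 4 2 (3 ^ b))))

2^-cancel-≤ : ∀ x y → 2 ^ x ≤ 2 ^ y → x ≤ y
2^-cancel-≤ x y le = ≮⇒≥ λ y<x → <⇒≱ (^-monoʳ-< 2 ≤-refl y<x) le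

-- Raising the hypothesis to the power `q` and bounding `3 ^ q` by `2 ^ p` gives
-- `x * q ≤ p * (k + k)`; the remaining factor 2 is at most a/b.
log-bound⇒LeC* : ∀ x k → 2 ^ x ≤ 3 ^ (k + k) → LeC* x k
log-bound⇒LeC* x k 2^x≤ p q a b (_ , 3^q<2^p) upper = begin
  x * q * b          ≤⟨ *-monoˡ-≤ b xq≤ ⟩
  p * (k + k) * b    ≡⟨ solve 3 (λ p k b → p :* (k :+ k) :* b := k :* p :* (b :+ b)) refl p k b ⟩
  k * p * (b + b)    ≤⟨ *-monoʳ-≤ (k * p) (2≤logφ3 a b upper) ⟩
  k * p * a          ∎
  where
  open ≤-Reasoning
  open +-*-Solver
  xq≤ : x * q ≤ p * (k + k)
  xq≤ = 2^-cancel-≤ _ _ (begin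
    2 ^ (x * q)          ≡⟨ sym (^-*-assoc 2 x q) ⟩
    (2 ^ x) ^ q          ≤⟨ ^-monoˡ-≤ q 2^x≤ ⟩
    (3 ^ (k + k)) ^ q    ≡⟨ ^-*-assoc 3 (k + k) q ⟩
    3 ^ ((k + k) * q)    ≡⟨ cong (3 ^_) (*-comm (k + k) q) ⟩
    3 ^ (q * (k + k))    ≡⟨ sym (^-*-assoc 3 q (k + k)) ⟩
    (3 ^ q) ^ (k + k)    ≤⟨ ^-monoˡ-≤ (k + k) (<⇒≤ 3^q<2^p) ⟩
    (2 ^ p) ^ (k + k)    ≡⟨ ^-*-assoc 2 p (k + k) ⟩
    2 ^ (p * (k + k))    ∎)

theorem3p12 : (n : ℕ) (T : Graph n) → IsTree T → (a b : ℕ) → IsChiCen T a → IsChiLin T b → LeC* a b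
theorem3p12 n T tree a b cen lin = log-bound⇒LeC* a b (centered≤linear T tree cen lin)
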